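{- Let $m,n,s,k$ be positive integers with $s$ and $k$ even. There exists a ${}^{2}\mathrm{H}(m,n;s,k)$ if and only if $ms=nk$, $2\le s\le n$, $2\le k\le m$, and $s,k$ are not both equal to $2$.
   Context: A partially filled (p.f.) array is a matrix in which some cells may be empty. With $ms=nk$, ${}^{2}\mathrm{H}(m,n;s,k)$ denotes an $m\times n$ p.f. array with entries in $\mathbb{Z}_{nk+1}$ such that: (a) each row has exactly $s$ filled cells and each column exactly $k$ filled cells; (b) the multiset $\{\pm x : x \text{ an entry of a filled cell}\}$ (with multiplicity) contains each nonzero element of $\mathbb{Z}_{nk+1}$ exactly $2$ times; (c) every row and column sums to $0$ in $\mathbb{Z}_{nk+1}$. -}

module Defs where

open import Data.Nat using (ℕ; zero; suc; _+_; _*_; _∸_; _≤_; _<_; NonZero)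
open import Data.Nat.DivMod using (_%_)
open import Data.Fin using (Fin; toℕ) renaming (zero to fzero; suc to fsuc)
open import Data.Maybe using (Maybe; just; nothing)
open import Data.Bool using (Bool; true; false; if_then_else_)
open import Data.Nat using (_≡ᵇ_)
open import Data.Product using (_×_)
open import Relation.Binary.PropositionalEquality using (_≡_)

∑ : (n : ℕ) → (Fin n → ℕ) → ℕ
∑ zero    f = 0
∑ (suc n) f = f fzero + ∑ n (λ i → f (fsuc i))

-- A partially filled m × n array with entries in ℤ_N (elements of ℤ_N
-- represented by their canonical representatives 0,…,N-1, i.e. Fin N);
-- an empty cell is 'nothing'.
PFArray : ℕ → ℕ → ℕ → Set
PFArray m n N = Fin m → Fin n → Maybe (Fin N)

filled : {N : ℕ} → Maybe (Fin N) → ℕ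
filled (just _) = 1
filled nothing  = 0

val : {N : ℕ} → Maybe (Fin N) → ℕ
val (just x) = toℕ x
val nothing  = 0

negMod : (N : ℕ) → .{{NonZero N}} → ℕ → ℕ
negMod N a = (N ∸ a) % N

-- multiplicity of x in the multiset {±e : e an entry of a filled cell}
-- contributed by one cell: [e = x] + [-e = x]
pmCount : (N : ℕ) → .{{NonZero N}} → ℕ → Maybe (Fin N) → ℕ
pmCount N x nothing  = 0
pmCount N x (just e) =
  (if toℕ e ≡ᵇ x then 1 else 0) + (if negMod N (toℕ e) ≡ᵇ x then 1 else 0)

record IsH2 (m n s k : ℕ) (A : PFArray m n (suc (n * k))) : Set where
  field
    rowFilled : ∀ i → ∑ n (λ j → filled (A i j)) ≡ s
    colFilled : ∀ j → ∑ m (λ i → filled (A i j)) ≡ k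
    twice     : ∀ (x : Fin (suc (n * k))) → 0 < toℕ x →
                ∑ m (λ i → ∑ n (λ j → pmCount (suc (n * k)) (toℕ x) (A i j))) ≡ 2
    rowSum    : ∀ i → ∑ n (λ j → val (A i j)) % suc (n * k) ≡ 0
    colSum    : ∀ j → ∑ m (λ i → val (A i j)) % suc (n * k) ≡ 0

-- existence of a ²H(m,n;s,k)  (the array size condition ms = nk is part
-- of the definition in the paper; we include it explicitly)
record H2 (m n s k : ℕ) : Set where
  field
    msnk  : m * s ≡ n * k
    array : PFArray m n (suc (n * k))
    isH2  : IsH2 m n s k array

{-# OPTIONS --safe #-}

-- Write s = 2h, k = 2k′ and E = mh = nk′, so that the modulus is 2E + 1. Transposing the array swaps
-- s and k, so we may assume h ≥ 2. Take m bundles of h labels each and put label t of bundle v into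
-- column t − (v+1)h mod n; as mh = k′n, the bundles wind k′ times around the columns and meet each column
-- k′ times. Let row v contain the labels of bundle v together with the negatives of the labels of bundle
-- π v, where π is a permutation taking each bundle to a cyclically adjacent one: since 2h ≤ n, the two sets
-- of columns are disjoint. Each column then consists of pairs z, −z, and it remains to sign 1, …, E and to
-- distribute them over the bundles so that bundles v and π v have the same sum modulo 2E + 1.
--   · Pairs −(x+1), x+2 have sum 1, which settles even h and reduces odd h to h = 3.
--   · For h = 3 and m odd, π is the rotation and the bundles form a signed Kotzig array.
--   · For h = 3 and m even, π swaps 2i and 2i+1, and translates of {1,…,12} are split into four bundles
--     using 1+3+7 = 2+4+5 and 6+10+12 = 8+9+11. If m ≡ 2 mod 4, the bundles {E, E−1, 2} and {1, 3, −4}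
--     come first; their sums are 2E+1 and 0.
-- Conversely, for s = k = 2 a cell ±1 forces another cell ±1 in its row and another one in its column.
module Submission where

open import Defs
open import Data.Bool using (if_then_else_)
open import Data.Nat
open import Data.Nat.Properties
open import Data.Nat.DivMod
open import Data.Nat.Divisibility using (_∣_; divides; divides-refl; ∣⇒≤; ∣m∣n⇒∣m+n; m%n≡0⇒n∣m; n∣m⇒m%n≡0)
open import Data.Nat.ListAction using (sum)
open import Data.Nat.Tactic.RingSolver using (solve-∀)
open import Data.Fin as Fin using (Fin; toℕ; punchIn; punchOut)
open import Data.Fin.Properties using (toℕ<n; toℕ-fromℕ<; punchIn-punchOut; punchInᵢ≢i)
open import Data.Integer as ℤ using (ℤ; +_; -[1+_]; ∣_∣; 0ℤ)
import Data.Integer.Divisibility.Signed as ℤ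
open import Data.Integer.DivMod using (_%ℕ_; _/ℕ_; n%ℕd<d; a≡a%ℕn+[a/ℕn]*n)
import Data.Integer.Properties as ℤ
import Data.Integer.Tactic.RingSolver as ℤ
open import Data.List using (List; []; _∷_; _++_; map; length)
open import Data.List.Properties using (length-++)
open import Data.Maybe as Maybe using (Maybe; just; nothing; maybe; _<∣>_)
open import Data.Product using (_×_; _,_; ∃; ∃₂; proj₁; proj₂)
open import Data.Sum using (_⊎_; inj₁; inj₂; swap)
open import Function using (_∘_)
open import Function.Bundles using (_⇔_; mk⇔)
open import Relation.Nullary using (¬_; yes; no; contradiction)
open import Relation.Nullary.Decidable using (does-⇔)
open import Relation.Binary.PropositionalEquality

-- Finite sums.

a+a≡a*2 : ∀ a → a + a ≡ a * 2
a+a≡a*2 = solve-∀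

a+b+c≡a+c+b : ∀ a b c → a + b + c ≡ a + c + b
a+b+c≡a+c+b = solve-∀

∑-cong : ∀ n {f g : Fin n → ℕ} → (∀ i → f i ≡ g i) → ∑ n f ≡ ∑ n g
∑-cong zero    e = refl
∑-cong (suc n) e = cong₂ _+_ (e Fin.zero) (∑-cong n (e ∘ Fin.suc))

∑-0 : ∀ n → ∑ n (λ _ → 0) ≡ 0
∑-0 zero    = refl
∑-0 (suc n) = ∑-0 n

∑-+ : ∀ n (f g : Fin n → ℕ) → ∑ n (λ i → f i + g i) ≡ ∑ n f + ∑ n g
∑-+ zero    f g = refl
∑-+ (suc n) f g = trans (cong (_+_ (f Fin.zero + g Fin.zero)) (∑-+ n (f ∘ Fin.suc) (g ∘ Fin.suc)))
  (interchange (f Fin.zero) (g Fin.zero) (∑ n (f ∘ Fin.suc)) (∑ n (g ∘ Fin.suc)))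
  where
  interchange : ∀ a b c d → a + b + (c + d) ≡ a + c + (b + d)
  interchange = solve-∀

∑-swap : ∀ m n (f : Fin m → Fin n → ℕ) →
  ∑ m (λ i → ∑ n (f i)) ≡ ∑ n (λ j → ∑ m (λ i → f i j))
∑-swap zero    n f = sym (∑-0 n)
∑-swap (suc m) n f = trans (cong (_+_ (∑ n (f Fin.zero))) (∑-swap m n (f ∘ Fin.suc)))
  (sym (∑-+ n (f Fin.zero) _))

∑-≤ : ∀ n {f : Fin n → ℕ} → (∀ i → f i ≤ 1) → ∑ n f ≤ n
∑-≤ zero    b = z≤n
∑-≤ (suc n) b = +-mono-≤ (b Fin.zero) (∑-≤ n (b ∘ Fin.suc))

∑-∣ : ∀ n {d} {f : Fin n → ℕ} → (∀ i → d ∣ f i) → d ∣ ∑ n f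
∑-∣ zero    e = divides 0 refl
∑-∣ (suc n) e = ∣m∣n⇒∣m+n (e Fin.zero) (∑-∣ n (e ∘ Fin.suc))

∑-punchIn : ∀ n (i : Fin (suc n)) (f : Fin (suc n) → ℕ) →
  ∑ (suc n) f ≡ f i + ∑ n (f ∘ punchIn i)
∑-punchIn n       Fin.zero    f = refl
∑-punchIn (suc n) (Fin.suc i) f = trans (cong (_+_ (f Fin.zero)) (∑-punchIn n i (f ∘ Fin.suc)))
  (exchange (f Fin.zero) (f (Fin.suc i)) _)
  where
  exchange : ∀ a b c → a + (b + c) ≡ b + (a + c)
  exchange = solve-∀

∑-positive : ∀ n {f : Fin n → ℕ} → 0 < ∑ n f → ∃ λ i → 0 < f i
∑-positive (suc n) {f} p with f Fin.zero in eq
... | suc _ = Fin.zero , subst (0 <_) (sym eq) z<s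
... | zero with i , q ← ∑-positive n p = Fin.suc i , q

Sum : ℕ → (ℕ → ℕ) → ℕ
Sum n f = ∑ n (f ∘ toℕ)

Sum-cong< : ∀ n {f g : ℕ → ℕ} → (∀ i → i < n → f i ≡ g i) → Sum n f ≡ Sum n g
Sum-cong< n e = ∑-cong n (λ i → e (toℕ i) (toℕ<n i))

Sum-cong : ∀ n {f g : ℕ → ℕ} → (∀ i → f i ≡ g i) → Sum n f ≡ Sum n g
Sum-cong n e = Sum-cong< n (λ i _ → e i)

Sum-snoc : ∀ n f → Sum n f + f n ≡ Sum (suc n) f
Sum-snoc zero    f = +-comm 0 (f 0)
Sum-snoc (suc n) f = trans (+-assoc (f 0) _ _) (cong (_+_ (f 0)) (Sum-snoc n (f ∘ suc)))

-- Raising the shift by one removes the first term and appends a term whose index agrees with the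
-- removed one modulo `n`.
Sum-cyclic : ∀ n .{{_ : NonZero n}} (g : ℕ → ℕ) c → Sum n (λ j → g ((j + c) % n)) ≡ Sum n g
Sum-cyclic n g zero    = Sum-cong< n λ i i<n →
  cong g (trans (cong (_% n) (+-identityʳ i)) (m<n⇒m%n≡m i<n))
Sum-cyclic n g (suc c) = trans (Sum-cong n λ j → cong (λ t → g (t % n)) (+-suc j c))
  (trans (+-cancelˡ-≡ (G 0) _ _ (trans (sym (Sum-snoc n G)) (trans (cong (_+_ (Sum n G)) wrap) (+-comm (Sum n G) (G 0)))))
         (Sum-cyclic n g c))
  where
  G : ℕ → ℕ
  G j = g ((j + c) % n)
  wrap : G n ≡ G 0
  wrap = cong g (trans (cong (_% n) (+-comm n c)) ([m+n]%n≡m%n c n))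

-- Windows of length `h` on a cycle of `n` columns.

module _ {A : Set} where

  at : List A → ℕ → Maybe A
  at []       _       = nothing
  at (x ∷ xs) zero    = just x
  at (x ∷ xs) (suc i) = at xs i

  at-< : ∀ xs {i} → i < length xs → ∃ λ x → at xs i ≡ just x
  at-< (x ∷ xs) {zero}  _       = x , refl
  at-< (x ∷ xs) {suc i} (s≤s p) = at-< xs p

  at-≥ : ∀ xs {i} → length xs ≤ i → at xs i ≡ nothing
  at-≥ []       _       = refl
  at-≥ (x ∷ xs) (s≤s p) = at-≥ xs p

  Sum-at : ∀ n (g : A → ℕ) xs → length xs ≤ n → Sum n (λ i → maybe g 0 (at xs i)) ≡ sum (map g xs)
  Sum-at n       g []       _       = ∑-0 n
  Sum-at (suc n) g (x ∷ xs) (s≤s p) = cong (_+_ (g x)) (Sum-at n g xs p)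

  occupied : Maybe A → ℕ
  occupied = maybe (λ _ → 1) 0

  module _ (n h : ℕ) .{{_ : NonZero n}} (h≤n : h ≤ n) where

    divMod-unique : ∀ {c} q {r} → c ≡ r + q * n → r < n → (c / n ≡ q) × (c % n ≡ r)
    divMod-unique q {r} refl r<n =
      trans (+-distrib-/-∣ʳ r (divides-refl q)) (cong₂ _+_ (m<n⇒m/n≡0 r<n) (m*n/n≡m q n)) ,
      trans ([m+kn]%n≡m%n r q n) (m<n⇒m%n≡m r<n)

    -- As `h ≤ n`, adding `h` to `c` passes at most one multiple of `n`. It passes one exactly when
    -- the new residue is below `h`, which is when the lookup in `xs` succeeds.
    floor-step : ∀ c xs → length xs ≡ h → (c + h) / n ≡ occupied (at xs ((c + h) % n)) + c / n
    floor-step c xs refl with c % n + h <? n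
    ... | yes r+h<n = trans d
        (cong (λ t → occupied t + c / n) (sym (trans (cong (at xs) e) (at-≥ xs (m≤n+m h (c % n))))))
      where
      de = divMod-unique {c + h} (c / n) (trans (cong (_+ h) (m≡m%n+[m/n]*n c n)) (a+b+c≡a+c+b (c % n) _ h)) r+h<n
      d = proj₁ de
      e = proj₂ de
    ... | no r+h≮n = trans d
        (cong (λ t → occupied t + c / n) (sym (trans (cong (at xs) e) (proj₂ (at-< xs t<h)))))
      where
      n≤r+h = ≮⇒≥ r+h≮n
      t = c % n + h ∸ n
      t+n : t + n ≡ c % n + h
      t+n = m∸n+n≡m n≤r+h
      t<h : t < h
      t<h = +-cancelʳ-< n t h (subst₂ _<_ (sym t+n) (+-comm n h) (+-monoˡ-< h (m%n<n c n)))
      de = divMod-unique {c + h} (suc (c / n)) (begin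
        c + h                       ≡⟨ cong (_+ h) (m≡m%n+[m/n]*n c n) ⟩
        c % n + c / n * n + h       ≡⟨ a+b+c≡a+c+b (c % n) _ h ⟩
        c % n + h + c / n * n       ≡⟨ cong (_+ c / n * n) (sym t+n) ⟩
        t + n + c / n * n           ≡⟨ +-assoc t n _ ⟩
        t + suc (c / n) * n         ∎) (<-≤-trans t<h h≤n)
        where open ≡-Reasoning
      d = proj₁ de
      e = proj₂ de

    -- Telescoping of `floor-step`: each bundle that meets the column raises the quotient by one.
    -- The start `c` is general because the induction advances it by `h`.
    window-count : ∀ m c (B : ℕ → List A) → (∀ v → v < m → length (B v) ≡ h) →
      Sum m (λ v → occupied (at (B v) ((c + suc v * h) % n))) + c / n ≡ (c + m * h) / n
    window-count zero    c B _   = cong (_/ n) (sym (+-identityʳ c))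
    window-count (suc m) c B len = begin
      o₀ + Sum m (λ v → occupied (at (B (suc v)) ((c + suc (suc v) * h) % n))) + c / n
        ≡⟨ cong₂ (λ t u → t + u + c / n) (cong (λ t → occupied (at (B 0) ((c + t) % n))) (+-identityʳ h))
                (Sum-cong m (λ v → cong (λ t → occupied (at (B (suc v)) (t % n))) (sym (+-assoc c h (suc v * h))))) ⟩
      o₁ + S + c / n
        ≡⟨ shift o₁ S _ ⟩
      S + (o₁ + c / n)
        ≡⟨ cong (_+_ S) (sym (floor-step c (B 0) (len 0 z<s))) ⟩
      S + (c + h) / n
        ≡⟨ window-count m (c + h) (B ∘ suc) (λ v p → len (suc v) (s<s p)) ⟩
      (c + h + m * h) / n
        ≡⟨ cong (_/ n) (+-assoc c h _) ⟩
      (c + suc m * h) / n ∎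
      where
      open ≡-Reasoning
      o₀ = occupied (at (B 0) ((c + 1 * h) % n))
      o₁ = occupied (at (B 0) ((c + h) % n))
      S  = Sum m (λ v → occupied (at (B (suc v)) ((c + h + suc v * h) % n)))
      shift : ∀ a b c → a + b + c ≡ b + (a + c)
      shift = solve-∀

-- Sums and absolute values of signed lists.

total : List ℤ → ℤ
total []       = 0ℤ
total (z ∷ zs) = z ℤ.+ total zs

total-++ : ∀ xs ys → total (xs ++ ys) ≡ total xs ℤ.+ total ys
total-++ []       ys = sym (ℤ.+-identityˡ _)
total-++ (x ∷ xs) ys = trans (cong (ℤ._+_ x) (total-++ xs ys)) (sym (ℤ.+-assoc x _ _))

module _ (f : ℕ → ℕ) where

  -- An equation between weights for every `f` expresses that two multisets of absolute values are
  -- equal.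
  weight : List ℤ → ℕ
  weight []       = 0
  weight (z ∷ zs) = f ∣ z ∣ + weight zs

  weight-++ : ∀ xs ys → weight (xs ++ ys) ≡ weight xs + weight ys
  weight-++ []       ys = refl
  weight-++ (x ∷ xs) ys = trans (cong (_+_ (f ∣ x ∣)) (weight-++ xs ys)) (sym (+-assoc (f ∣ x ∣) _ _))

  -- Ranges over ]a, a + l].
  interval : ℕ → ℕ → ℕ
  interval a zero    = 0
  interval a (suc l) = f (suc a) + interval (suc a) l

  interval-+ : ∀ a k l → interval a (k + l) ≡ interval a k + interval (a + k) l
  interval-+ a zero    l = cong (λ t → interval t l) (sym (+-identityʳ a))
  interval-+ a (suc k) l = trans (cong (_+_ (f (suc a)))
    (trans (interval-+ (suc a) k l) (cong (λ t → interval (suc a) k + interval t l) (sym (+-suc a k)))))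
    (sym (+-assoc (f (suc a)) _ _))

  interval≡Sum : ∀ a l → interval a l ≡ Sum l (λ i → f (suc a + i))
  interval≡Sum a zero    = refl
  interval≡Sum a (suc l) = cong₂ _+_ (cong (f ∘ suc) (sym (+-identityʳ a)))
    (trans (interval≡Sum (suc a) l) (Sum-cong l (λ i → cong (f ∘ suc) (sym (+-suc a i)))))

-- Families of signed bundles.

pairs : ℕ → ℕ → List ℤ
pairs x zero    = []
pairs x (suc q) = -[1+ x ] ∷ + (2 + x) ∷ pairs (2 + x) q

length-pairs : ∀ x q → length (pairs x q) ≡ q * 2
length-pairs x zero    = refl
length-pairs x (suc q) = cong (_+_ 2) (length-pairs (2 + x) q)

-- Each pair adds 1 wherever its range starts, so bundles cut from different ranges have equal sums.
total-pairs : ∀ x q → total (pairs x q) ≡ + q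
total-pairs x zero    = refl
total-pairs x (suc q) = trans (cong (λ t → -[1+ x ] ℤ.+ (+ (2 + x) ℤ.+ t)) (total-pairs (2 + x) q))
  (identity (+ x) (+ q))
  where
  identity : ∀ x q → ℤ.- (+ 1 ℤ.+ x) ℤ.+ (+ 2 ℤ.+ x ℤ.+ q) ≡ + 1 ℤ.+ q
  identity = ℤ.solve-∀

weight-pairs : ∀ f x q → weight f (pairs x q) ≡ interval f x (q * 2)
weight-pairs f x zero    = refl
weight-pairs f x (suc q) = cong (λ t → f (1 + x) + (f (2 + x) + t)) (weight-pairs f (2 + x) q)

weight-blocks : ∀ f m x q → Sum m (λ v → weight f (pairs (x + v * (q * 2)) q)) ≡ interval f x (m * (q * 2))
weight-blocks f zero    x q = refl
weight-blocks f (suc m) x q = begin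
  weight f (pairs (x + 0) q) + Sum m (λ v → weight f (pairs (x + (l + v * l)) q))
    ≡⟨ cong₂ _+_ (trans (weight-pairs f (x + 0) q) (cong (λ t → interval f t l) (+-identityʳ x)))
                 (Sum-cong m (λ v → cong (λ t → weight f (pairs t q)) (sym (+-assoc x l (v * l))))) ⟩
  interval f x l + Sum m (λ v → weight f (pairs (x + l + v * l) q))
    ≡⟨ cong (_+_ (interval f x l)) (weight-blocks f m (x + l) q) ⟩
  interval f x l + interval f (x + l) (m * l)
    ≡⟨ sym (interval-+ f x l (m * l)) ⟩
  interval f x (l + m * l) ∎
  where
  open ≡-Reasoning
  l = q * 2

-- Bundles 2i and 2i+1 of the Kotzig array with m = 2g+1 are (1+i, m+1+g+i, −(2m+1+2i)) and
-- (g+2+i, m+1+i, −(2m+2+2i)); all sums are −g. The parameter i is the number of bundle pairs skipped.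
kotzig : ℕ → ℕ → ℕ → List ℤ
kotzig g i zero          = + (1 + i) ∷ + (2 + (g * 2 + g + i)) ∷ -[1+ (2 + (g * 4 + i * 2)) ] ∷ []
kotzig g i (suc zero)    = + (2 + (g + i)) ∷ + (2 + (g * 2 + i)) ∷ -[1+ (3 + (g * 4 + i * 2)) ] ∷ []
kotzig g i (suc (suc v)) = kotzig g (suc i) v

length-kotzig : ∀ g i v → length (kotzig g i v) ≡ 3
length-kotzig g i zero          = refl
length-kotzig g i (suc zero)    = refl
length-kotzig g i (suc (suc v)) = length-kotzig g (suc i) v

total-kotzig : ∀ g i v → total (kotzig g i v) ≡ ℤ.- + g
total-kotzig g i zero = trans
  (cong₂ (λ a b → + (1 + i) ℤ.+ (+ 2 ℤ.+ (a ℤ.+ + g ℤ.+ + i) ℤ.+ (ℤ.- (+ 3 ℤ.+ b) ℤ.+ 0ℤ)))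
         (ℤ.pos-* g 2) (cong₂ ℤ._+_ (ℤ.pos-* g 4) (ℤ.pos-* i 2)))
  (identity (+ g) (+ i))
  where
  identity : ∀ g i →
    + 1 ℤ.+ i ℤ.+ (+ 2 ℤ.+ (g ℤ.* + 2 ℤ.+ g ℤ.+ i) ℤ.+ (ℤ.- (+ 3 ℤ.+ (g ℤ.* + 4 ℤ.+ i ℤ.* + 2)) ℤ.+ 0ℤ))
    ≡ ℤ.- g
  identity = ℤ.solve-∀
total-kotzig g i (suc zero) = trans
  (cong₂ (λ a b → + (2 + (g + i)) ℤ.+ (+ 2 ℤ.+ (a ℤ.+ + i) ℤ.+ (ℤ.- (+ 4 ℤ.+ b) ℤ.+ 0ℤ)))
         (ℤ.pos-* g 2) (cong₂ ℤ._+_ (ℤ.pos-* g 4) (ℤ.pos-* i 2)))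
  (identity (+ g) (+ i))
  where
  identity : ∀ g i →
    + 2 ℤ.+ (g ℤ.+ i) ℤ.+ (+ 2 ℤ.+ (g ℤ.* + 2 ℤ.+ i) ℤ.+ (ℤ.- (+ 4 ℤ.+ (g ℤ.* + 4 ℤ.+ i ℤ.* + 2)) ℤ.+ 0ℤ))
    ≡ ℤ.- g
  identity = ℤ.solve-∀
total-kotzig g i (suc (suc v)) = total-kotzig g (suc i) v

-- The intervals collect, in this order, the first entries of the even and of the odd bundles, the
-- second entries of the odd and of the even bundles, and the absolute values of all third entries.
weight-kotzig-from : ∀ f g r i → Sum (1 + r * 2) (λ v → weight f (kotzig g i v)) ≡
  (interval f i (1 + r) + interval f (1 + (g + i)) r)
    + (interval f (1 + (g * 2 + i)) r + interval f (1 + (g * 2 + g + i)) (1 + r))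
    + interval f (2 + (g * 4 + i * 2)) (1 + r * 2)
weight-kotzig-from f g zero i = rearrange (f (1 + i)) (f (2 + (g * 2 + g + i))) (f (3 + (g * 4 + i * 2)))
  where
  rearrange : ∀ a b c → a + (b + (c + 0)) + 0 ≡ a + 0 + 0 + (b + 0) + (c + 0)
  rearrange = solve-∀
weight-kotzig-from f g (suc r) i
  rewrite weight-kotzig-from f g r (suc i) | +-suc g i | +-suc (g * 2) i | +-suc (g * 2 + g) i
        | +-suc (g * 4) (suc (i * 2)) | +-suc (g * 4) (i * 2)
  = rearrange (f (1 + i)) (f (2 + (g * 2 + g + i))) (f (3 + (g * 4 + i * 2)))
      (f (2 + (g + i))) (f (2 + (g * 2 + i))) (f (4 + (g * 4 + i * 2)))
      (f (2 + i)) _ _ _ (f (3 + (g * 2 + g + i))) _ _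
  where
  rearrange : ∀ a b c d e h k p q r s t u →
    a + (b + (c + 0)) + (d + (e + (h + 0)) + (k + p + q + (r + (s + t)) + u)) ≡
    (a + (k + p)) + (d + q) + (e + r + (b + (s + t))) + (c + (h + u))
  rearrange = solve-∀

-- For `r = g` and `i = 0` the five intervals lie end to end: the first, second and third entries
-- fill ]0, m], ]m, 2m] and ]2m, 3m] with m = 2g + 1.
weight-kotzig : ∀ f g → Sum (1 + g * 2) (λ v → weight f (kotzig g 0 v)) ≡ interval f 0 ((1 + g * 2) * 3)
weight-kotzig f g
  rewrite weight-kotzig-from f g g 0 | +-identityʳ g | +-identityʳ (g * 2) | +-identityʳ (g * 2 + g) | +-identityʳ (g * 4)
  = begin
  I 0 (1 + g) + I (1 + g) g + (I (1 + g * 2) g + I (1 + (g * 2 + g)) (1 + g)) + I (2 + g * 4) m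
    ≡⟨ cong₂ (λ a b → a + b + I (2 + g * 4) m)
         (trans (sym (interval-+ f 0 (1 + g) g)) (cong (I 0) (double g)))
         (trans (sym (interval-+ f m g (1 + g))) (cong (I m) (trans (+-suc g g) (double g)))) ⟩
  I 0 m + I m m + I (2 + g * 4) m
    ≡⟨ cong₂ (λ a b → a + I b m) (sym (interval-+ f 0 m m)) (quadruple g) ⟩
  I 0 (m + m) + I (m + m) m
    ≡⟨ sym (interval-+ f 0 (m + m) m) ⟩
  I 0 (m + m + m)
    ≡⟨ cong (I 0) (triple m) ⟩
  I 0 (m * 3) ∎
  where
  open ≡-Reasoning
  m = 1 + g * 2
  I = interval f
  double : ∀ g → 1 + g + g ≡ 1 + g * 2
  double = solve-∀
  quadruple : ∀ g → 2 + g * 4 ≡ 1 + g * 2 + (1 + g * 2)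
  quadruple = solve-∀
  triple : ∀ m → m + m + m ≡ m * 3
  triple = solve-∀

partner : ℕ → ℕ
partner zero          = 1
partner (suc zero)    = 0
partner (suc (suc v)) = suc (suc (partner v))

Sum-partner : ∀ p f → Sum (p * 2) (f ∘ partner) ≡ Sum (p * 2) f
Sum-partner zero    f = refl
Sum-partner (suc p) f = trans (cong (λ t → f 1 + (f 0 + t)) (Sum-partner p (λ v → f (2 + v))))
  (exchange (f 1) (f 0) _)
  where
  exchange : ∀ a b c → a + (b + c) ≡ b + (a + c)
  exchange = solve-∀

window : ℕ → ℕ → List ℤ
window x 0 = + (1 + x) ∷ + (3 + x) ∷ + (7 + x) ∷ []
window x 1 = + (2 + x) ∷ + (4 + x) ∷ + (5 + x) ∷ []
window x 2 = + (6 + x) ∷ + (10 + x) ∷ + (12 + x) ∷ []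
window x 3 = + (8 + x) ∷ + (9 + x) ∷ + (11 + x) ∷ []
window x (suc (suc (suc (suc v)))) = window (12 + x) v

length-window : ∀ x v → length (window x v) ≡ 3
length-window x 0 = refl
length-window x 1 = refl
length-window x 2 = refl
length-window x 3 = refl
length-window x (suc (suc (suc (suc v)))) = length-window (12 + x) v

-- Both triples have three positive entries, so translation by `x` adds 3x to each side of 1+3+7 =
-- 2+4+5 and of 6+10+12 = 8+9+11.
total-window-partner : ∀ x v → total (window x v) ≡ total (window x (partner v))
total-window-partner x 0 = identity (+ x)
  where
  identity : ∀ x → + 1 ℤ.+ x ℤ.+ (+ 3 ℤ.+ x ℤ.+ (+ 7 ℤ.+ x ℤ.+ 0ℤ)) ≡ + 2 ℤ.+ x ℤ.+ (+ 4 ℤ.+ x ℤ.+ (+ 5 ℤ.+ x ℤ.+ 0ℤ))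
  identity = ℤ.solve-∀
total-window-partner x 1 = sym (total-window-partner x 0)
total-window-partner x 2 = identity (+ x)
  where
  identity : ∀ x →
    + 6 ℤ.+ x ℤ.+ (+ 10 ℤ.+ x ℤ.+ (+ 12 ℤ.+ x ℤ.+ 0ℤ))
    ≡ + 8 ℤ.+ x ℤ.+ (+ 9 ℤ.+ x ℤ.+ (+ 11 ℤ.+ x ℤ.+ 0ℤ))
  identity = ℤ.solve-∀
total-window-partner x 3 = sym (total-window-partner x 2)
total-window-partner x (suc (suc (suc (suc v)))) = total-window-partner (12 + x) v

weight-window : ∀ f r x → Sum (r * 4) (λ v → weight f (window x v)) ≡ interval f x (r * 12)
weight-window f zero    x = refl
weight-window f (suc r) x rewrite weight-window f r (12 + x) =
  rearrange (f (1 + x)) (f (2 + x)) (f (3 + x)) (f (4 + x)) (f (5 + x)) (f (6 + x))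
    (f (7 + x)) (f (8 + x)) (f (9 + x)) (f (10 + x)) (f (11 + x)) (f (12 + x)) _
  where
  rearrange : ∀ a b c d e f g h i j k l s →
    a + (c + (g + 0)) + (b + (d + (e + 0)) + (f + (j + (l + 0)) + (h + (i + (k + 0)) + s)))
    ≡ a + (b + (c + (d + (e + (f + (g + (h + (i + (j + (k + (l + s)))))))))))
  rearrange = solve-∀

-- Balanced labellings for every h ≥ 2.

CyclicallyAdjacent : ℕ → ℕ → ℕ → Set
CyclicallyAdjacent m v w = (w ≡ suc v) ⊎ (v ≡ suc w) ⊎ (v ≡ 0 × suc w ≡ m)

-- With E = mh the modulus in `balanced` is 2E + 1. Quantified over `f`, `Sum-π` encodes that `π`
-- permutes the first `m` bundles, and `weights` that the absolute values are 1, ..., E, each once.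
record Labelling (m h : ℕ) : Set where
  field
    bundle   : ℕ → List ℤ
    π        : ℕ → ℕ
    size     : ∀ v → length (bundle v) ≡ h
    Sum-π    : ∀ f → Sum m (f ∘ π) ≡ Sum m f
    adjacent : ∀ v → CyclicallyAdjacent m v (π v)
    balanced : ∀ v → + suc (m * (h * 2)) ℤ.∣ total (bundle v) ℤ.- total (bundle (π v))
    weights  : ∀ f → Sum m (λ v → weight f (bundle v)) ≡ interval f 0 (m * h)

equal⇒∣ : ∀ {d x y} → x ≡ y → d ℤ.∣ x ℤ.- y
equal⇒∣ {x = x} refl = ℤ.divides 0ℤ (ℤ.+-inverseʳ x)

rotate : ℕ → ℕ → ℕ
rotate m zero    = m
rotate m (suc v) = v

Sum-rotate : ∀ m f → Sum (suc m) (f ∘ rotate m) ≡ Sum (suc m) f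
Sum-rotate m f = trans (+-comm (f m) _) (Sum-snoc m f)

-- The rotation steps down by one and wraps only from bundle 0 to the last, which is why
-- `CyclicallyAdjacent` lists the wrap-around in this direction.
adjacent-rotate : ∀ m v → CyclicallyAdjacent (suc m) v (rotate m v)
adjacent-rotate m zero    = inj₂ (inj₂ (refl , refl))
adjacent-rotate m (suc v) = inj₂ (inj₁ refl)

adjacent-partner : ∀ m v → CyclicallyAdjacent m v (partner v)
adjacent-partner m 0 = inj₁ refl
adjacent-partner m 1 = inj₂ (inj₁ refl)
-- Taking 0 for the number of bundles makes the wrap-around case absurd; the two neighbour cases
-- survive the shift by 2.
adjacent-partner m (suc (suc v)) with adjacent-partner 0 v
... | inj₁ e        = inj₁ (cong (_+_ 2) e)
... | inj₂ (inj₁ e) = inj₂ (inj₁ (cong (_+_ 2) e))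
... | inj₂ (inj₂ ())

-- All bundles have sum `q`, so every permutation is balanced; the rotation is adjacent for any
-- number of bundles.
labelling-even : ∀ m q → Labelling (suc m) (q * 2)
labelling-even m q = record
  { bundle   = λ v → pairs (v * (q * 2)) q
  ; π        = rotate m
  ; size     = λ v → length-pairs (v * (q * 2)) q
  ; Sum-π    = Sum-rotate m
  ; adjacent = adjacent-rotate m
  ; balanced = λ v → equal⇒∣ (trans (total-pairs _ q) (sym (total-pairs _ q)))
  ; weights  = λ f → weight-blocks f (suc m) 0 q
  }

module _ (m q : ℕ) (π : ℕ → ℕ) (Sum-π : ∀ f → Sum m (f ∘ π) ≡ Sum m f)
  (adjacent : ∀ v → CyclicallyAdjacent m v (π v)) (T : ℕ → List ℤ) (x : ℕ)
  (size : ∀ v → length (T v) ≡ 3)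
  (balanced : ∀ v → + suc (m * ((3 + q * 2) * 2)) ℤ.∣ total (T v) ℤ.- total (T (π v)))
  (weights : ∀ f → Sum m (λ v → weight f (T v)) + interval f x (m * (q * 2)) ≡ interval f 0 (m * (3 + q * 2)))
  where

  -- Extending every triple by `q` pairs raises all sums by the same `q`, so the balance of the
  -- triples carries over. The pairs fill a range starting after `x`, and the triples may lie on
  -- both sides of it.
  labelling-from-triples : Labelling m (3 + q * 2)
  labelling-from-triples = record
    { bundle   = λ v → T v ++ pairs (x + v * (q * 2)) q
    ; π        = π
    ; size     = λ v → trans (length-++ (T v)) (cong₂ _+_ (size v) (length-pairs (x + v * (q * 2)) q))
    ; Sum-π    = Sum-π
    ; adjacent = adjacent
    ; balanced = λ v → subst (ℤ._∣_ _) (sym (trans (cong₂ ℤ._-_ (total-T v) (total-T (π v)))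
                   (cancel (total (T v)) (total (T (π v))) (+ q)))) (balanced v)
    ; weights  = λ f → trans
        (trans (Sum-cong m (λ v → weight-++ f (T v) (pairs (x + v * (q * 2)) q)))
          (trans (∑-+ m _ _) (cong (_+_ (Sum m (λ v → weight f (T v)))) (weight-blocks f m x q))))
        (weights f)
    }
    where
    total-T : ∀ v → total (T v ++ pairs (x + v * (q * 2)) q) ≡ total (T v) ℤ.+ + q
    total-T v = trans (total-++ (T v) _) (cong (ℤ._+_ (total (T v))) (total-pairs _ q))
    cancel : ∀ a b c → a ℤ.+ c ℤ.- (b ℤ.+ c) ≡ a ℤ.- b
    cancel = ℤ.solve-∀

labelling-odd-odd : ∀ g q → Labelling (1 + g * 2) (3 + q * 2)
labelling-odd-odd g q = labelling-from-triples m q (rotate (g * 2)) (Sum-rotate (g * 2)) (adjacent-rotate (g * 2))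
  (kotzig g 0) (m * 3) (length-kotzig g 0)
  (λ v → equal⇒∣ (trans (total-kotzig g 0 v) (sym (total-kotzig g 0 (rotate (g * 2) v)))))
  λ f → trans (cong (λ t → t + interval f (m * 3) (m * (q * 2))) (weight-kotzig f g))
    (trans (sym (interval-+ f 0 (m * 3) _)) (cong (interval f 0) (sym (*-distribˡ-+ m 3 (q * 2)))))
  where
  m = 1 + g * 2

labelling-4r-odd : ∀ r q → Labelling (r * 4) (3 + q * 2)
labelling-4r-odd r q = labelling-from-triples (r * 4) q partner
  (subst (λ m → ∀ f → Sum m (f ∘ partner) ≡ Sum m f) (*-assoc r 2 2) (Sum-partner (r * 2))) (adjacent-partner (r * 4))
  (window 0) (r * 12) (length-window 0)
  (λ v → equal⇒∣ (total-window-partner 0 v))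
  λ f → trans (cong (λ t → t + interval f (r * 12) (r * 4 * (q * 2))) (weight-window f r 0))
    (trans (sym (interval-+ f 0 (r * 12) _)) (cong (interval f 0) (distrib r q)))
  where
  distrib : ∀ r q → r * 12 + r * 4 * (q * 2) ≡ r * 4 * (3 + q * 2)
  distrib = solve-∀

-- With E = 2 + top, the first triple adds up to E + (E - 1) + 2 = 2E + 1, which is the modulus.
windowsModulo : ℕ → ℕ → List ℤ
windowsModulo top 0             = + (2 + top) ∷ + (1 + top) ∷ + 2 ∷ []
windowsModulo top 1             = + 1 ∷ + 3 ∷ -[1+ 3 ] ∷ []
windowsModulo top (suc (suc v)) = window 4 v

-- Here E/2 and E + 1 are odd, so 1 + ... + E is odd, whereas equal integer sums in swapped bundles
-- would make the signed total even. Hence one swap is balanced only modulo 2E + 1. The windows fill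
-- ]4, 4 + 12r] and the pairs continue up to E - 2.
labelling-4r+2-odd : ∀ r q → Labelling (2 + r * 4) (3 + q * 2)
labelling-4r+2-odd r q = labelling-from-triples m q partner
  (subst (λ m → ∀ f → Sum m (f ∘ partner) ≡ Sum m f) (cong (_+_ 2) (*-assoc r 2 2)) (Sum-partner (1 + r * 2)))
  (adjacent-partner m) (windowsModulo top) (4 + r * 12) size balanced weights
  where
  m = 2 + r * 4
  top = 4 + (r * 12 + m * (q * 2))
  size : ∀ v → length (windowsModulo top v) ≡ 3
  size 0 = refl
  size 1 = refl
  size (suc (suc v)) = length-window 4 v
  modulus : ∀ r q → 2 + (4 + (r * 12 + (2 + r * 4) * (q * 2))) + (1 + (4 + (r * 12 + (2 + r * 4) * (q * 2))) + 2)
                    ≡ suc ((2 + r * 4) * ((3 + q * 2) * 2))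
  modulus = solve-∀
  balanced : ∀ v → + suc (m * ((3 + q * 2) * 2)) ℤ.∣ total (windowsModulo top v) ℤ.- total (windowsModulo top (partner v))
  balanced 0 = ℤ.divides (+ 1) (trans (ℤ.+-identityʳ _) (trans (cong +_ (modulus r q)) (sym (ℤ.*-identityˡ _))))
  balanced 1 = ℤ.divides (ℤ.- + 1) (trans (cong (λ t → ℤ.- + t) (modulus r q)) (sym (ℤ.-1*i≡-i _)))
  balanced (suc (suc v)) = equal⇒∣ (total-window-partner 4 v)
  total-length : ∀ r q → 6 + (r * 12 + (2 + r * 4) * (q * 2)) ≡ (2 + r * 4) * (3 + q * 2)
  total-length = solve-∀
  weights : ∀ f → Sum m (λ v → weight f (windowsModulo top v)) + interval f (4 + r * 12) (m * (q * 2))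
                  ≡ interval f 0 (m * (3 + q * 2))
  weights f = begin
    f (2 + top) + (f (1 + top) + (f 2 + 0)) + (f 1 + (f 3 + (f 4 + 0)) + Sum (r * 4) (λ v → weight f (window 4 v)))
      + interval f (4 + r * 12) (m * (q * 2))
      ≡⟨ cong (λ t → f (2 + top) + (f (1 + top) + (f 2 + 0)) + (f 1 + (f 3 + (f 4 + 0)) + t) + interval f (4 + r * 12) (m * (q * 2))) (weight-window f r 4) ⟩
    f (2 + top) + (f (1 + top) + (f 2 + 0)) + (f 1 + (f 3 + (f 4 + 0)) + interval f 4 (r * 12))
      + interval f (4 + r * 12) (m * (q * 2))
      ≡⟨ rearrange (f (2 + top)) (f (1 + top)) (f 2) (f 1) (f 3) (f 4) (interval f 4 (r * 12)) _ ⟩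
    f 1 + (f 2 + (f 3 + (f 4 + (interval f 4 (r * 12) + interval f (4 + r * 12) (m * (q * 2)))))) + interval f top 2
      ≡⟨ cong (λ t → f 1 + (f 2 + (f 3 + (f 4 + t))) + interval f top 2) (sym (interval-+ f 4 (r * 12) _)) ⟩
    interval f 0 top + interval f top 2
      ≡⟨ sym (interval-+ f 0 top 2) ⟩
    interval f 0 (top + 2)
      ≡⟨ cong (interval f 0) (trans (+-comm top 2) (total-length r q)) ⟩
    interval f 0 (m * (3 + q * 2)) ∎
    where
    open ≡-Reasoning
    rearrange : ∀ a b c d e g u w → a + (b + (c + 0)) + (d + (e + (g + 0)) + u) + w
                                     ≡ d + (c + (e + (g + (u + w)))) + (b + (a + 0))
    rearrange = solve-∀

evenOrOdd : ∀ n → ∃ λ q → (n ≡ q * 2) ⊎ (n ≡ 1 + q * 2)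
evenOrOdd zero = 0 , inj₁ refl
evenOrOdd (suc n) with evenOrOdd n
... | q , inj₁ e = q , inj₂ (cong suc e)
... | q , inj₂ e = suc q , inj₁ (cong suc e)

labelling : ∀ m h → 0 < m → 2 ≤ h → Labelling m h
labelling (suc m) h@(suc (suc h′)) _ _ with evenOrOdd h
... | q     , inj₁ e rewrite e = labelling-even m q
-- An odd h ≥ 2 is 1 + 2(q + 1) = 3 + 2q; a quotient 0 would mean h = 1.
... | suc q , inj₂ e with evenOrOdd (suc m)
...   | g , inj₂ e′ = subst₂ Labelling (sym e′) (sym e) (labelling-odd-odd g q)
...   | p , inj₁ e′ with evenOrOdd p
...     | r , inj₁ refl = subst₂ Labelling (sym (trans e′ (*-assoc r 2 2))) (sym e) (labelling-4r-odd r q)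
...     | r , inj₂ refl = subst₂ Labelling (sym (trans e′ (cong (_+_ 2) (*-assoc r 2 2)))) (sym e) (labelling-4r+2-odd r q)
labelling (suc m) (suc zero) _ (s≤s ())

-- Residues modulo 2E + 1 and occurrences of ±x.

δ : ℕ → ℕ → ℕ
δ y i = if i ≡ᵇ y then 1 else 0

Sum-δ-≥ : ∀ n y → n ≤ y → Sum n (δ y) ≡ 0
Sum-δ-≥ zero    y       _       = refl
Sum-δ-≥ (suc n) (suc y) (s≤s p) = Sum-δ-≥ n y p

Sum-δ-< : ∀ n y → y < n → Sum n (δ y) ≡ 1
Sum-δ-< (suc n) zero    _       = cong suc (∑-0 n)
Sum-δ-< (suc n) (suc y) (s≤s p) = Sum-δ-< n y p

module Residues (M : ℕ) where

  N : ℕ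
  N = suc M

  residue : ℤ → Fin N
  residue z = Fin.fromℕ< (n%ℕd<d z N)

  toℕ-residue : ∀ z → toℕ (residue z) ≡ z %ℕ N
  toℕ-residue z = toℕ-fromℕ< (n%ℕd<d z N)

  residue-∣ : ∀ z → + N ℤ.∣ + toℕ (residue z) ℤ.- z
  residue-∣ z = ℤ.divides (ℤ.- (z /ℕ N)) (begin
    + toℕ (residue z) ℤ.- z
      ≡⟨ cong₂ (λ a b → + a ℤ.- b) (toℕ-residue z) (a≡a%ℕn+[a/ℕn]*n z N) ⟩
    + (z %ℕ N) ℤ.- (+ (z %ℕ N) ℤ.+ z /ℕ N ℤ.* + N)
      ≡⟨ cancel (+ (z %ℕ N)) (z /ℕ N) (+ N) ⟩
    ℤ.- (z /ℕ N) ℤ.* + N ∎)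
    where
    open ≡-Reasoning
    cancel : ∀ a b c → a ℤ.- (a ℤ.+ b ℤ.* c) ≡ ℤ.- b ℤ.* c
    cancel = ℤ.solve-∀

  -- A row needs this twice: with `φ` the identity for its own bundle and with negation for the
  -- other one.
  sum-residues-∣ : ∀ (φ : ℤ → ℤ) zs → + N ℤ.∣ + sum (map (λ z → toℕ (residue (φ z))) zs) ℤ.- total (map φ zs)
  sum-residues-∣ φ []       = ℤ.divides 0ℤ refl
  sum-residues-∣ φ (z ∷ zs) = subst (ℤ._∣_ (+ N))
    (rearrange (+ toℕ (residue (φ z))) (φ z) (+ sum (map (λ z → toℕ (residue (φ z))) zs)) (total (map φ zs)))
    (ℤ.∣m∣n⇒∣m+n (residue-∣ (φ z)) (sum-residues-∣ φ zs))
    where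
    rearrange : ∀ a b c d → a ℤ.- b ℤ.+ (c ℤ.- d) ≡ a ℤ.+ c ℤ.- (b ℤ.+ d)
    rearrange = ℤ.solve-∀

  total-map-id : ∀ zs → total (map (λ z → z) zs) ≡ total zs
  total-map-id []       = refl
  total-map-id (z ∷ zs) = cong (ℤ._+_ z) (total-map-id zs)

  total-map-neg : ∀ zs → total (map ℤ.-_ zs) ≡ ℤ.- total zs
  total-map-neg []       = refl
  total-map-neg (z ∷ zs) = trans (cong (ℤ._+_ (ℤ.- z)) (total-map-neg zs)) (sym (ℤ.neg-distrib-+ z (total zs)))

  residue-opposite : ∀ z → N ∣ toℕ (residue z) + toℕ (residue (ℤ.- z))
  residue-opposite z = ℤ.∣⇒∣ᵤ (subst (ℤ._∣_ (+ N)) (cancel (+ toℕ (residue z)) z (+ toℕ (residue (ℤ.- z))))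
    (ℤ.∣m∣n⇒∣m+n (residue-∣ z) (residue-∣ (ℤ.- z))))
    where
    cancel : ∀ a b c → a ℤ.- b ℤ.+ (c ℤ.- (ℤ.- b)) ≡ a ℤ.+ c
    cancel = ℤ.solve-∀

  -- This gives the row sums: modulo `N` the residues add up to the difference of the two integer
  -- totals.
  sum-opposite : ∀ ys zs → + N ℤ.∣ total ys ℤ.- total zs →
    N ∣ sum (map (λ z → toℕ (residue z)) ys) + sum (map (λ z → toℕ (residue (ℤ.- z))) zs)
  sum-opposite ys zs d = ℤ.∣⇒∣ᵤ (subst (ℤ._∣_ (+ N)) eq
    (ℤ.∣m∣n⇒∣m+n (ℤ.∣m∣n⇒∣m+n (sum-residues-∣ (λ z → z) ys) (sum-residues-∣ ℤ.-_ zs)) d))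
    where
    a b : ℕ
    a = sum (map (λ z → toℕ (residue z)) ys)
    b = sum (map (λ z → toℕ (residue (ℤ.- z))) zs)
    cancel : ∀ a b t u → a ℤ.- t ℤ.+ (b ℤ.- (ℤ.- u)) ℤ.+ (t ℤ.- u) ≡ a ℤ.+ b
    cancel = ℤ.solve-∀
    eq : + a ℤ.- total (map (λ z → z) ys) ℤ.+ (+ b ℤ.- total (map ℤ.-_ zs)) ℤ.+ (total ys ℤ.- total zs) ≡ + (a + b)
    eq = trans (cong₂ (λ t u → + a ℤ.- t ℤ.+ (+ b ℤ.- u) ℤ.+ (total ys ℤ.- total zs)) (total-map-id ys) (total-map-neg zs))
               (cancel (+ a) (+ b) (total ys) (total zs))

  -- The sum is a multiple of `N` below 2N, hence 0 or `N`. If it is 0, both numbers vanish and the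
  -- final reduction in `negMod` turns `N` into 0.
  negMod-+ : ∀ {a b} → a < N → b < N → N ∣ a + b → negMod N a ≡ b
  negMod-+ {a} {b} a<N b<N (divides 0 e) rewrite m+n≡0⇒m≡0 a e | m+n≡0⇒n≡0 a e = n%n≡0 N
  negMod-+ {a} {b} a<N b<N (divides 1 e) = trans
    (cong (_% N) (trans (cong (_∸ a) (trans (sym (*-identityˡ N)) (sym e))) (m+n∸m≡n a b)))
    (m<n⇒m%n≡m b<N)
  negMod-+ {a} {b} a<N b<N (divides (suc (suc q)) e) with () ← <⇒≱ (+-mono-< a<N b<N)
    (subst (N + N ≤_) (sym e) (+-monoʳ-≤ N (m≤m+n N (q * N))))

  negMod-residue : ∀ z → negMod N (toℕ (residue z)) ≡ toℕ (residue (ℤ.- z))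
  negMod-residue z = negMod-+ (toℕ<n (residue z)) (toℕ<n (residue (ℤ.- z))) (residue-opposite z)

  occurrences : ℕ → ℤ → ℕ
  occurrences x z = pmCount N x (just (residue z))

  occurrences-δ : ∀ x z → occurrences x z ≡ δ x (toℕ (residue z)) + δ x (toℕ (residue (ℤ.- z)))
  occurrences-δ x z = cong (λ t → δ x (toℕ (residue z)) + δ x t) (negMod-residue z)

  occurrences-neg : ∀ x z → occurrences x (ℤ.- z) ≡ occurrences x z
  occurrences-neg x z = begin
    occurrences x (ℤ.- z)
      ≡⟨ occurrences-δ x (ℤ.- z) ⟩
    δ x (toℕ (residue (ℤ.- z))) + δ x (toℕ (residue (ℤ.- (ℤ.- z))))
      ≡⟨ cong (λ t → δ x (toℕ (residue (ℤ.- z))) + δ x (toℕ (residue t))) (ℤ.neg-involutive z) ⟩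
    δ x (toℕ (residue (ℤ.- z))) + δ x (toℕ (residue z))
      ≡⟨ +-comm (δ x (toℕ (residue (ℤ.- z)))) _ ⟩
    δ x (toℕ (residue z)) + δ x (toℕ (residue (ℤ.- z)))
      ≡⟨ sym (occurrences-δ x z) ⟩
    occurrences x z ∎
    where open ≡-Reasoning

  -- An entry is counted together with its negative, so signs do not matter and the counts become
  -- instances of `weight`.
  occurrences-abs : ∀ x z → occurrences x z ≡ occurrences x (+ ∣ z ∣)
  occurrences-abs x (+ n)    = refl
  occurrences-abs x -[1+ n ] = occurrences-neg x (+ suc n)

  sum-occurrences : ∀ x zs → sum (map (occurrences x) zs) ≡ weight (λ y → occurrences x (+ y)) zs
  sum-occurrences x []       = refl
  sum-occurrences x (z ∷ zs) = cong₂ _+_ (occurrences-abs x z) (sum-occurrences x zs)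

  sum-occurrences-neg : ∀ x zs → sum (map (occurrences x ∘ ℤ.-_) zs) ≡ weight (λ y → occurrences x (+ y)) zs
  sum-occurrences-neg x []       = refl
  sum-occurrences-neg x (z ∷ zs) = cong₂ _+_ (trans (occurrences-neg x z) (occurrences-abs x z)) (sum-occurrences-neg x zs)

  module _ (E : ℕ) (M≡ : M ≡ E * 2) where

    -- Of x and N - x, which add up to 2E + 1, exactly one is at most E.
    interval-occurrences : ∀ x → 0 < x → x < N → interval (λ y → occurrences x (+ y)) 0 E ≡ 1
    interval-occurrences (suc y) _ (s≤s y<M) = begin
      interval (λ y′ → occurrences (suc y) (+ y′)) 0 E
        ≡⟨ interval≡Sum _ 0 E ⟩
      Sum E (λ i → occurrences (suc y) (+ suc i))
        ≡⟨ Sum-cong< E occurrences-suc ⟩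
      Sum E (λ i → δ y i + δ ȳ i)
        ≡⟨ ∑-+ E _ _ ⟩
      Sum E (δ y) + Sum E (δ ȳ)
        ≡⟨ exactly-one ⟩
      1 ∎
      where
      open ≡-Reasoning
      -- Indices start at 0, so x is `suc y` and N - x is `suc ȳ`.
      ȳ = M ∸ suc y
      y+ȳ : suc y + ȳ ≡ M
      y+ȳ = m+[n∸m]≡n y<M
      E+E : E + E ≡ M
      E+E = trans (a+a≡a*2 E) (sym M≡)
      exactly-one : Sum E (δ y) + Sum E (δ ȳ) ≡ 1
      exactly-one with y <? E
      ... | yes y<E = cong₂ _+_ (Sum-δ-< E y y<E)
                        (Sum-δ-≥ E ȳ (≮⇒≥ λ ȳ<E → <⇒≢ (+-mono-≤-< y<E ȳ<E) (trans y+ȳ (sym E+E))))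
      ... | no  y≮E = cong₂ _+_ (Sum-δ-≥ E y (≮⇒≥ y≮E))
                        (Sum-δ-< E ȳ (≰⇒> λ E≤ȳ → <⇒≢ (+-mono-<-≤ (s≤s (≮⇒≥ y≮E)) E≤ȳ) (trans E+E (sym y+ȳ))))
      occurrences-suc : ∀ i → i < E → occurrences (suc y) (+ suc i) ≡ δ y i + δ ȳ i
      occurrences-suc i i<E
        rewrite toℕ-residue (+ suc i) | m<n⇒m%n≡m {n = N} {m = suc i} (s≤s (≤-trans i<E (m+n≤o⇒m≤o E (≤-reflexive E+E))))
              | m<n⇒m%n≡m {n = N} {m = M ∸ i} (s≤s (m∸n≤m M i))
        -- The first summands agree by computation. In the second, each boolean test is the `does`
        -- of a decision of equality, so an equivalence of the two equations suffices.
        = cong (λ b → δ y i + (if b then 1 else 0)) (does-⇔ (mk⇔ to from) (M ∸ i ≟ suc y) (i ≟ ȳ))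
        where
        i<M : i ≤ M
        i<M = ≤-trans (<⇒≤ i<E) (m+n≤o⇒m≤o E (≤-reflexive E+E))
        to : M ∸ i ≡ suc y → i ≡ ȳ
        to e = trans (sym (m∸[m∸n]≡n i<M)) (cong (M ∸_) e)
        from : i ≡ ȳ → M ∸ i ≡ suc y
        from refl = m∸[m∸n]≡n y<M

-- Arrays with the modulus as a parameter.

record Heffter (M m n s k : ℕ) : Set where
  field
    array     : PFArray m n (suc M)
    rowFilled : ∀ i → ∑ n (λ j → filled (array i j)) ≡ s
    colFilled : ∀ j → ∑ m (λ i → filled (array i j)) ≡ k
    twice     : ∀ (x : Fin (suc M)) → 0 < toℕ x →
                ∑ m (λ i → ∑ n (λ j → pmCount (suc M) (toℕ x) (array i j))) ≡ 2
    rowSum    : ∀ i → ∑ n (λ j → val (array i j)) % suc M ≡ 0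
    colSum    : ∀ j → ∑ m (λ i → val (array i j)) % suc M ≡ 0

-- Because `M` is kept apart from the dimensions, the entries keep their type when rows and columns
-- are exchanged.
transpose : ∀ {M m n s k} → Heffter M m n s k → Heffter M n m k s
transpose {M} {m} {n} H = record
  { array     = λ j i → array i j
  ; rowFilled = colFilled
  ; colFilled = rowFilled
  ; twice     = λ x 0<x → trans (sym (∑-swap m n (λ i j → pmCount (suc M) (toℕ x) (array i j)))) (twice x 0<x)
  ; rowSum    = colSum
  ; colSum    = rowSum
  }
  where open Heffter H

-- The array built from a labelling.

module Construction (m n h k : ℕ) .{{_ : NonZero n}} (L : Labelling m h)
  (2h≤n : h + h ≤ n) (mh≡kn : m * h ≡ k * n) where

  open Labelling L
  open Residues (m * (h * 2))

  -- Label t lies in column t - (v+1)h modulo `n`. The factor is v+1 and not v because `floor-step`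
  -- inspects the residue after `h` has been added.
  cell : ℕ → ℕ → Maybe ℤ
  cell v j = at (bundle v) ((j + suc v * h) % n)

  -- If the first lookup succeeds, the residue of `c` is below `h`. As 2h ≤ n, adding `h` does not
  -- wrap around, and the new residue is past the end of the second bundle.
  consecutive-disjoint : ∀ c v w → at (bundle v) (c % n) ≡ nothing ⊎ at (bundle w) ((c + h) % n) ≡ nothing
  consecutive-disjoint c v w with c % n <? h
  ... | no  ≮h = inj₁ (at-≥ (bundle v) (≤-trans (≤-reflexive (size v)) (≮⇒≥ ≮h)))
  ... | yes <h = inj₂ (at-≥ (bundle w) (≤-trans (≤-reflexive (size w)) (≤-trans (m≤n+m h (c % n)) (≤-reflexive (sym c+h%n)))))
    where
    c+h%n : (c + h) % n ≡ c % n + h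
    c+h%n = trans (%-distribˡ-+ c h n) (trans (cong (λ t → (c % n + t) % n) (m<n⇒m%n≡m h<n))
              (m<n⇒m%n≡m (<-≤-trans (+-monoˡ-< h <h) 2h≤n)))
      where
      h<n : h < n
      h<n = <-≤-trans (m<m+n h (≤-<-trans z≤n <h)) 2h≤n

  disjoint-suc : ∀ v j → cell v j ≡ nothing ⊎ cell (suc v) j ≡ nothing
  disjoint-suc v j = subst (λ t → cell v j ≡ nothing ⊎ at (bundle (suc v)) (t % n) ≡ nothing)
    (shift j h (suc v * h)) (consecutive-disjoint (j + suc v * h) v (suc v))
    where
    shift : ∀ a b c → a + c + b ≡ a + (b + c)
    shift = solve-∀

  disjoint : ∀ v w j → CyclicallyAdjacent m v w → cell v j ≡ nothing ⊎ cell w j ≡ nothing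
  disjoint v .(suc v) j (inj₁ refl) = disjoint-suc v j
  disjoint .(suc w) w j (inj₂ (inj₁ refl)) = swap (disjoint-suc w j)
  -- The last bundle has offset mh, a multiple of `n`, so bundle 0 with offset `h` comes directly
  -- after it.
  disjoint .0 w j (inj₂ (inj₂ (refl , refl))) = swap (subst₂
    (λ a b → at (bundle w) a ≡ nothing ⊎ at (bundle 0) ((j + b) % n) ≡ nothing)
    (sym (trans (cong (λ t → (j + t) % n) mh≡kn) ([m+kn]%n≡m%n j k n))) (sym (+-identityʳ h))
    (consecutive-disjoint j w 0))

  -- By `disjoint` at most one alternative is present, so the preference for the left one hides no
  -- label.
  entry : ℕ → ℕ → Maybe (Fin N)
  entry v j = Maybe.map residue (cell v j <∣> Maybe.map ℤ.-_ (cell (π v) j))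

  module _ (G : Maybe (Fin N) → ℕ) (G-nothing : G nothing ≡ 0) where

    private
      g g⁻ : ℤ → ℕ
      g  z = G (just (residue z))
      g⁻ z = G (just (residue (ℤ.- z)))

    -- With `filled`, `pmCount` and `val` in place of `G`, one computation serves all conditions on
    -- the array.
    G-entry : ∀ v j → G (entry v j) ≡ maybe g 0 (cell v j) + maybe g⁻ 0 (cell (π v) j)
    G-entry v j with cell v j | cell (π v) j | disjoint v (π v) j (adjacent v)
    ... | nothing | nothing | _      = G-nothing
    ... | nothing | just z  | _      = refl
    ... | just z  | nothing | _      = sym (+-identityʳ (g z))
    ... | just z  | just z′ | inj₁ ()
    ... | just z  | just z′ | inj₂ ()

    Sum-cells : ∀ (f : ℤ → ℕ) v w → Sum n (λ j → maybe f 0 (at (bundle v) ((j + suc w * h) % n))) ≡ sum (map f (bundle v))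
    Sum-cells f v w = trans (Sum-cyclic n (λ t → maybe f 0 (at (bundle v) t)) (suc w * h))
      (Sum-at n f (bundle v) (≤-trans (≤-reflexive (size v)) (m+n≤o⇒m≤o h 2h≤n)))

    Sum-row : ∀ v → Sum n (λ j → G (entry v j)) ≡ sum (map g (bundle v)) + sum (map g⁻ (bundle (π v)))
    Sum-row v = trans (Sum-cong n (G-entry v)) (trans (∑-+ n _ _)
      (cong₂ _+_ (Sum-cells g v v) (Sum-cells g⁻ (π v) (π v))))

    -- A label and its negated copy stand in the same column, in rows related by `π`. Reindexing by
    -- `Sum-π` brings the two together.
    Sum-column : ∀ j → Sum m (λ v → G (entry v j)) ≡ Sum m (λ v → maybe (λ z → g z + g⁻ z) 0 (cell v j))
    Sum-column j = begin
      Sum m (λ v → G (entry v j))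
        ≡⟨ Sum-cong m (λ v → G-entry v j) ⟩
      Sum m (λ v → maybe g 0 (cell v j) + maybe g⁻ 0 (cell (π v) j))
        ≡⟨ ∑-+ m _ _ ⟩
      Sum m (λ v → maybe g 0 (cell v j)) + Sum m (λ v → maybe g⁻ 0 (cell (π v) j))
        ≡⟨ cong (_+_ (Sum m (λ v → maybe g 0 (cell v j)))) (Sum-π (λ v → maybe g⁻ 0 (cell v j))) ⟩
      Sum m (λ v → maybe g 0 (cell v j)) + Sum m (λ v → maybe g⁻ 0 (cell v j))
        ≡⟨ sym (∑-+ m _ _) ⟩
      Sum m (λ v → maybe g 0 (cell v j) + maybe g⁻ 0 (cell v j))
        ≡⟨ Sum-cong m (λ v → merge (cell v j)) ⟩
      Sum m (λ v → maybe (λ z → g z + g⁻ z) 0 (cell v j)) ∎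
      where
      open ≡-Reasoning
      merge : ∀ c → maybe g 0 c + maybe g⁻ 0 c ≡ maybe (λ z → g z + g⁻ z) 0 c
      merge (just _) = refl
      merge nothing  = refl

  sum-ones : ∀ (zs : List ℤ) → sum (map (λ _ → 1) zs) ≡ length zs
  sum-ones []       = refl
  sum-ones (_ ∷ zs) = cong suc (sum-ones zs)

  heffter : Heffter (m * (h * 2)) m n (h * 2) (k * 2)
  heffter = record
    { array     = λ i j → entry (toℕ i) (toℕ j)
    ; rowFilled = λ i → let v = toℕ i in trans (Sum-row filled refl v)
        (trans (cong₂ _+_ (trans (sum-ones (bundle v)) (size v)) (trans (sum-ones (bundle (π v))) (size (π v)))) (a+a≡a*2 h))
    ; colFilled = λ j → trans (Sum-column filled refl (toℕ j)) (column-count (toℕ j))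
    -- Every bundle enters once as it is and once negated, in another row. By `Sum-π` both
    -- contributions are the weight of 1, ..., E, which is 1.
    ; twice     = λ x 0<x → let f = λ y → occurrences (toℕ x) (+ y) in
        trans (Sum-cong m (λ v → trans (Sum-row (pmCount N (toℕ x)) refl v)
                (cong₂ _+_ (sum-occurrences (toℕ x) (bundle v)) (sum-occurrences-neg (toℕ x) (bundle (π v))))))
        (trans (∑-+ m _ _) (trans (cong (_+_ (Sum m (λ v → weight f (bundle v)))) (Sum-π (λ v → weight f (bundle v))))
        (cong (λ t → t + t) (trans (weights f)
          (interval-occurrences (m * h) (sym (*-assoc m h 2)) (toℕ x) 0<x (toℕ<n x))))))
    ; rowSum    = λ i → let v = toℕ i in n∣m⇒m%n≡0 _ N (subst (N ∣_) (sym (Sum-row val refl v))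
        (sum-opposite (bundle v) (bundle (π v)) (balanced v)))
    ; colSum    = λ j → n∣m⇒m%n≡0 _ N (subst (N ∣_) (sym (Sum-column val refl (toℕ j)))
        (∑-∣ m (λ i → column-∣ (cell (toℕ i) (toℕ j)))))
    }
    where
    column-∣ : ∀ c → N ∣ maybe (λ z → toℕ (residue z) + toℕ (residue (ℤ.- z))) 0 c
    column-∣ (just z) = residue-opposite z
    column-∣ nothing  = divides 0 refl
    column-count : ∀ j → Sum m (λ v → maybe (λ _ → 2) 0 (cell v j)) ≡ k * 2
    column-count j = begin
      Sum m (λ v → maybe (λ _ → 2) 0 (cell v j))
        ≡⟨ Sum-cong m (λ v → two (cell v j)) ⟩
      Sum m (λ v → occupied (cell v j) + occupied (cell v j))
        ≡⟨ ∑-+ m _ _ ⟩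
      Sum m (λ v → occupied (cell v j)) + Sum m (λ v → occupied (cell v j))
        ≡⟨ a+a≡a*2 (Sum m (λ v → occupied (cell v j))) ⟩
      Sum m (λ v → occupied (cell v j)) * 2
        -- Over all `m` bundles the quotient by `n` grows from j/n by mh/n = k.
        ≡⟨ cong (_* 2) (+-cancelʳ-≡ (j / n) _ k (trans (window-count n h (m+n≤o⇒m≤o h 2h≤n) m j bundle (λ v _ → size v)) full)) ⟩
      k * 2 ∎
      where
      open ≡-Reasoning
      two : ∀ c → maybe (λ _ → 2) 0 c ≡ occupied c + occupied c
      two (just _) = refl
      two nothing  = refl
      full : (j + m * h) / n ≡ k + j / n
      full = trans (cong (λ t → (j + t) / n) mh≡kn) (trans (+-distrib-/-∣ʳ j (divides-refl k))
        (trans (cong (_+_ (j / n)) (m*n/n≡m k n)) (+-comm (j / n) k)))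

-- Nonexistence for s = k = 2.

∑-≥₁ : ∀ n (f : Fin n → ℕ) i → f i ≤ ∑ n f
∑-≥₁ (suc n) f i = ≤-trans (m≤m+n (f i) _) (≤-reflexive (sym (∑-punchIn n i f)))

∑-≥₂ : ∀ n (f : Fin n → ℕ) {i j} → i ≢ j → f i + f j ≤ ∑ n f
∑-≥₂ (suc n) f {i} {j} i≢j = ≤-trans
  (+-monoʳ-≤ (f i) (≤-trans (≤-reflexive (cong f (sym (punchIn-punchOut i≢j)))) (∑-≥₁ n (f ∘ punchIn i) (punchOut i≢j))))
  (≤-reflexive (sym (∑-punchIn n i f)))

filled≤1 : ∀ {N} (c : Maybe (Fin N)) → filled c ≤ 1
filled≤1 (just _) = ≤-refl
filled≤1 nothing  = z≤n

∑-val-empty : ∀ {N} n (f : Fin n → Maybe (Fin N)) → ∑ n (filled ∘ f) ≡ 0 → ∑ n (val ∘ f) ≡ 0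
∑-val-empty zero    f _ = refl
∑-val-empty (suc n) f e with f Fin.zero
... | nothing = ∑-val-empty n (f ∘ Fin.suc) e

∑-val-singleton : ∀ {N} n (f : Fin n → Maybe (Fin N)) → ∑ n (filled ∘ f) ≡ 1 →
  ∃₂ λ i e → f i ≡ just e × ∑ n (val ∘ f) ≡ toℕ e
∑-val-singleton (suc n) f one with f Fin.zero in f0
... | just e  = Fin.zero , e , f0 ,
  trans (cong (_+_ (toℕ e)) (∑-val-empty n (f ∘ Fin.suc) (suc-injective one))) (+-identityʳ (toℕ e))
... | nothing with i , e , fi , sum ← ∑-val-singleton n (f ∘ Fin.suc) one = Fin.suc i , e , fi , sum

module _ (M : ℕ) where

  open Residues M using (negMod-+)

  pmCount-opposite : ∀ x (e e′ : Fin (suc M)) → (toℕ e + toℕ e′) % suc M ≡ 0 →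
    pmCount (suc M) x (just e) ≡ pmCount (suc M) x (just e′)
  pmCount-opposite x e e′ e+e′ = begin
    δ x (toℕ e) + δ x (negMod (suc M) (toℕ e))
      ≡⟨ cong (λ t → δ x (toℕ e) + δ x t) (negMod-+ (toℕ<n e) (toℕ<n e′) d) ⟩
    δ x (toℕ e) + δ x (toℕ e′)
      ≡⟨ +-comm (δ x (toℕ e)) _ ⟩
    δ x (toℕ e′) + δ x (toℕ e)
      ≡⟨ cong (λ t → δ x (toℕ e′) + δ x t) (sym (negMod-+ (toℕ<n e′) (toℕ<n e) (subst (suc M ∣_) (+-comm (toℕ e) _) d))) ⟩
    δ x (toℕ e′) + δ x (negMod (suc M) (toℕ e′)) ∎
    where
    open ≡-Reasoning
    d : suc M ∣ toℕ e + toℕ e′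
    d = m%n≡0⇒n∣m _ (suc M) e+e′

  -- The only other entry of the line must be the negative of the given one, and it contributes the
  -- same to the count of ±x.
  opposite-in-line : ∀ n (f : Fin n → Maybe (Fin (suc M))) → ∑ n (filled ∘ f) ≡ 2 → ∑ n (val ∘ f) % suc M ≡ 0 →
    ∀ x j → 0 < pmCount (suc M) x (f j) → ∃ λ j′ → j ≢ j′ × 0 < pmCount (suc M) x (f j′)
  opposite-in-line (suc n) f two zero-sum x j pos with f j in fj
  ... | just e with i , e′ , fi , sum ← ∑-val-singleton n (f ∘ punchIn j)
                     (suc-injective (trans (cong (λ c → filled c + ∑ n (filled ∘ f ∘ punchIn j)) (sym fj))
                       (trans (sym (∑-punchIn n j (filled ∘ f))) two)))
    = punchIn j i , (λ eq → punchInᵢ≢i j i (sym eq)) ,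
      subst (λ c → 0 < pmCount (suc M) x c) (sym fi) (subst (0 <_) (pmCount-opposite x e e′ (trans (cong (_% suc M) vals) zero-sum)) pos)
    where
    vals : toℕ e + toℕ e′ ≡ ∑ (suc n) (val ∘ f)
    vals = sym (trans (∑-punchIn n j (val ∘ f)) (cong₂ _+_ (cong val fj) sum))

-- The cells (i, j), (i, j′) and (i′, j) are distinct, and each contributes at least 1 to the count
-- of ±1, which is 2. As n > 0, the modulus exceeds 1, so that 1 is a nonzero residue.
¬H2-2-2 : ∀ m n → 0 < n → ¬ H2 m n 2 2
¬H2-2-2 m (suc n) _ H
  with i , row+ ← ∑-positive m (≤-trans z<s (≤-reflexive (sym (IsH2.twice (H2.isH2 H) (Fin.suc Fin.zero) z<s))))
  with j , cell+ ← ∑-positive (suc n) row+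
  with j′ , j≢j′ , cell+₁ ← opposite-in-line (suc n * 2) (suc n) (λ j → H2.array H i j)
                              (IsH2.rowFilled (H2.isH2 H) i) (IsH2.rowSum (H2.isH2 H) i) 1 j cell+
  with i′ , i≢i′ , cell+₂ ← opposite-in-line (suc n * 2) m (λ i → H2.array H i j)
                              (IsH2.colFilled (H2.isH2 H) j) (IsH2.colSum (H2.isH2 H) j) 1 i cell+
  = <⇒≱ {2} {3} ≤-refl (begin
      3                                 ≤⟨ +-mono-≤ (+-mono-≤ cell+ cell+₁) cell+₂ ⟩
      p i j + p i j′ + p i′ j           ≤⟨ +-mono-≤ (∑-≥₂ (suc n) (p i) j≢j′) (∑-≥₁ (suc n) (p i′) j) ⟩
      ∑ (suc n) (p i) + ∑ (suc n) (p i′) ≤⟨ ∑-≥₂ m (λ i → ∑ (suc n) (p i)) i≢i′ ⟩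
      ∑ m (λ i → ∑ (suc n) (p i))       ≡⟨ IsH2.twice (H2.isH2 H) (Fin.suc Fin.zero) z<s ⟩
      2                                 ∎)
  where
  open ≤-Reasoning
  p : Fin m → Fin (suc n) → ℕ
  p i j = pmCount (suc (suc n * 2)) 1 (H2.array H i j)

-- Existence and the equivalence.

heffter-exists : ∀ m n h k → 0 < m → 2 ≤ h → h * 2 ≤ n → m * (h * 2) ≡ n * (k * 2) →
  Heffter (m * (h * 2)) m n (h * 2) (k * 2)
heffter-exists m n h k 0<m 2≤h h*2≤n e = Construction.heffter m n h k {{n≢0}} (labelling m h 0<m 2≤h)
  (≤-trans (≤-reflexive (a+a≡a*2 h)) h*2≤n)
  (*-cancelʳ-≡ (m * h) (k * n) 2 (trans (*-assoc m h 2) (trans e (trans (sym (*-assoc n k 2)) (cong (_* 2) (*-comm n k))))))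
  where
  n≢0 : NonZero n
  n≢0 = >-nonZero (≤-trans (≤-trans (s≤s z≤n) (*-monoˡ-≤ 2 (<⇒≤ 2≤h))) h*2≤n)

heffter⇒H2 : ∀ {m n s k} → m * s ≡ n * k → Heffter (n * k) m n s k → H2 m n s k
heffter⇒H2 msnk H = record
  { msnk  = msnk
  ; array = array
  ; isH2  = record { rowFilled = rowFilled ; colFilled = colFilled ; twice = twice ; rowSum = rowSum ; colSum = colSum }
  }
  where open Heffter H

theorem4p10 : (m n s k : ℕ) → 0 < m → 0 < n → 0 < s → 0 < k → 2 ∣ s → 2 ∣ k →
    (H2 m n s k ⇔ ((m * s ≡ n * k) × (2 ≤ s) × (s ≤ n) × (2 ≤ k) × (k ≤ m) × ¬ ((s ≡ 2) × (k ≡ 2))))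
theorem4p10 m@(suc _) n@(suc _) s k 0<m 0<n 0<s 0<k 2∣s 2∣k = mk⇔ necessity (sufficiency 2∣s 2∣k)
  where
  necessity : H2 m n s k → (m * s ≡ n * k) × (2 ≤ s) × (s ≤ n) × (2 ≤ k) × (k ≤ m) × ¬ ((s ≡ 2) × (k ≡ 2))
  necessity H = msnk , ∣⇒≤ {{>-nonZero 0<s}} 2∣s ,
    subst (_≤ n) (rowFilled Fin.zero) (∑-≤ n (λ j → filled≤1 (array Fin.zero j))) ,
    ∣⇒≤ {{>-nonZero 0<k}} 2∣k ,
    subst (_≤ m) (colFilled Fin.zero) (∑-≤ m (λ i → filled≤1 (array i Fin.zero))) ,
    λ { (refl , refl) → ¬H2-2-2 m n 0<n H }
    where
    open H2 H
    open IsH2 isH2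
  sufficiency : ∀ {s k} → 2 ∣ s → 2 ∣ k →
    (m * s ≡ n * k) × (2 ≤ s) × (s ≤ n) × (2 ≤ k) × (k ≤ m) × ¬ ((s ≡ 2) × (k ≡ 2)) → H2 m n s k
  sufficiency (divides 0 refl) _ (_ , () , _)
  sufficiency _ (divides 0 refl) (_ , _ , _ , () , _)
  sufficiency (divides 1 refl) (divides 1 refl) (_ , _ , _ , _ , _ , ¬2-2) = contradiction (refl , refl) ¬2-2
  sufficiency (divides h@(suc (suc _)) refl) (divides k refl) (e , _ , s≤n , _) =
    heffter⇒H2 e (subst (λ M → Heffter M m n (h * 2) (k * 2)) e (heffter-exists m n h k 0<m (s≤s (s≤s z≤n)) s≤n e))
  -- For s = 2 it is k/2 that is at least 2, so the construction is run with rows and columns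
  -- exchanged and its result is transposed.
  sufficiency (divides 1 refl) (divides k@(suc (suc _)) refl) (e , _ , _ , _ , k≤m , _) =
    heffter⇒H2 e (transpose (heffter-exists n m k 1 0<n (s≤s (s≤s z≤n)) k≤m (sym e)))
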